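{- Let $\mathsf{V}$ be a variety of Heyting algebras and $\mathbf{A}$ a Heyting algebra such that $\mathbf{A}+\mathbf{Z}_2\in\mathsf{V}$ is $\mathsf{V}$-projective. Then: (a) if $\mathbf{A}+\mathbf{Z}_2+\mathbf{Z}_2\in\mathsf{V}$, then $\mathbf{A}+\mathbf{Z}_2+\mathbf{Z}_2$ is $\mathsf{V}$-projective; (b) if $\mathbf{A}+\mathbf{Z}_4+\mathbf{Z}_2\in\mathsf{V}$, then $\mathbf{A}+\mathbf{Z}_4+\mathbf{Z}_2$ is $\mathsf{V}$-projective.
   Context: Heyting algebras are algebras $(A;\land,\lor,\to,\neg)$ with $(A;\land,\lor)$ a bounded distributive lattice, $\to$ the relative pseudocomplement and $\neg x=x\to\mathbf{0}$. For Heyting algebras $\mathbf{A},\mathbf{B}$, the coalesced ordinal sum $\mathbf{A}+\mathbf{B}$ is the Heyting algebra obtained by placing $\mathbf{B}$ above $\mathbf{A}$ and identifying the top of $\mathbf{A}$ with the bottom of $\mathbf{B}$ ($+$ is associative). $\mathbf{Z}_2$ is the two-element Boolean algebra and $\mathbf{Z}_4$ is the four-element Boolean algebra. An algebra $\mathbf{C}\in\mathsf{V}$ is $\mathsf{V}$-projective if for all $\mathbf{A}_1,\mathbf{A}_2\in\mathsf{V}$, every surjective homomorphism $h:\mathbf{A}_1\to\mathbf{A}_2$ and every homomorphism $f:\mathbf{C}\to\mathbf{A}_2$, there is a homomorphism $g:\mathbf{C}\to\mathbf{A}_1$ with $hg=f$. -}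

module Defs where

open import Level using (Level; _⊔_; 0ℓ) renaming (suc to lsuc)
open import Data.Nat using (ℕ)
open import Data.Bool using (Bool; true; false; _∧_; _∨_; not; _≤_; b≤b; f≤t)
open import Data.Bool.Properties using (≤-isPartialOrder)
open import Data.Product using (_×_; _,_; proj₁; proj₂; Σ; ∃)
open import Data.Sum using (_⊎_)
open import Relation.Binary.PropositionalEquality using (_≡_; refl; isEquivalence; cong₂)
open import Relation.Binary.Lattice.Bundles using (HeytingAlgebra)
open import Relation.Binary.Structures using (IsPartialOrder; IsPreorder)
open import Relation.Unary using (Pred; _∈_)

private
  ⇨₂ : Bool → Bool → Bool
  ⇨₂ x y = not x ∨ y

  sup₂ : ∀ x y → (x ≤ (x ∨ y)) × (y ≤ (x ∨ y)) × (∀ z → x ≤ z → y ≤ z → (x ∨ y) ≤ z)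
  sup₂ false false = b≤b , b≤b , λ _ p _ → p
  sup₂ false true  = f≤t , b≤b , λ _ _ q → q
  sup₂ true  false = b≤b , f≤t , λ _ p _ → p
  sup₂ true  true  = b≤b , b≤b , λ _ p _ → p

  inf₂ : ∀ x y → ((x ∧ y) ≤ x) × ((x ∧ y) ≤ y) × (∀ z → z ≤ x → z ≤ y → z ≤ (x ∧ y))
  inf₂ false false = b≤b , b≤b , λ _ p _ → p
  inf₂ false true  = b≤b , f≤t , λ _ p _ → p
  inf₂ true  false = f≤t , b≤b , λ _ _ q → q
  inf₂ true  true  = b≤b , b≤b , λ _ p _ → p

  top₂ : ∀ x → x ≤ true
  top₂ false = f≤t
  top₂ true  = b≤b

  bot₂ : ∀ x → false ≤ x
  bot₂ false = b≤b
  bot₂ true  = f≤t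

  exp₂ : ∀ w x y → (((w ∧ x) ≤ y) → (w ≤ ⇨₂ x y)) × ((w ≤ ⇨₂ x y) → ((w ∧ x) ≤ y))
  exp₂ false x y = (λ _ → bot₂ _) , (λ _ → bot₂ y)
  exp₂ true false y = (λ _ → b≤b) , (λ _ → bot₂ y)
  exp₂ true true y = (λ p → p) , (λ p → p)

Z₂ : HeytingAlgebra 0ℓ 0ℓ 0ℓ
Z₂ = record
  { Carrier = Bool ; _≈_ = _≡_ ; _≤_ = _≤_ ; _∨_ = _∨_ ; _∧_ = _∧_ ; _⇨_ = ⇨₂
  ; ⊤ = true ; ⊥ = false
  ; isHeytingAlgebra = record
    { isBoundedLattice = record
      { isLattice = record
        { isPartialOrder = ≤-isPartialOrder
        ; supremum = sup₂
        ; infimum = inf₂ }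
      ; maximum = top₂
      ; minimum = bot₂ }
    ; exponential = exp₂ } }

private
  B4 : Set
  B4 = Bool × Bool

  _≤₄_ : B4 → B4 → Set
  (a , b) ≤₄ (c , d) = (a ≤ c) × (b ≤ d)

  _∧₄_ _∨₄_ _⇨₄_ : B4 → B4 → B4
  (a , b) ∧₄ (c , d) = (a ∧ c , b ∧ d)
  (a , b) ∨₄ (c , d) = (a ∨ c , b ∨ d)
  (a , b) ⇨₄ (c , d) = (⇨₂ a c , ⇨₂ b d)

  po₄ : IsPartialOrder _≡_ _≤₄_
  po₄ = record
    { isPreorder = record
      { isEquivalence = isEquivalence
      ; reflexive = λ { refl → P.refl , P.refl }
      ; trans = λ { (p , q) (p' , q') → P.trans p p' , P.trans q q' } }
    ; antisym = λ { (p , q) (p' , q') → cong₂ _,_ (P.antisym p p') (P.antisym q q') } }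
    where module P = IsPartialOrder ≤-isPartialOrder

Z₄ : HeytingAlgebra 0ℓ 0ℓ 0ℓ
Z₄ = record
  { Carrier = B4 ; _≈_ = _≡_ ; _≤_ = _≤₄_ ; _∨_ = _∨₄_ ; _∧_ = _∧₄_ ; _⇨_ = _⇨₄_
  ; ⊤ = (true , true) ; ⊥ = (false , false)
  ; isHeytingAlgebra = record
    { isBoundedLattice = record
      { isLattice = record
        { isPartialOrder = po₄
        ; supremum = λ { (a , b) (c , d) →
            let (p1 , p2 , p3) = sup₂ a c ; (q1 , q2 , q3) = sup₂ b d in
            (p1 , q1) , (p2 , q2) , λ { (e , f) (r , s) (r' , s') → p3 e r r' , q3 f s s' } }
        ; infimum = λ { (a , b) (c , d) →
            let (p1 , p2 , p3) = inf₂ a c ; (q1 , q2 , q3) = inf₂ b d in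
            (p1 , q1) , (p2 , q2) , λ { (e , f) (r , s) (r' , s') → p3 e r r' , q3 f s s' } } }
      ; maximum = λ { (a , b) → top₂ a , top₂ b }
      ; minimum = λ { (a , b) → bot₂ a , bot₂ b } }
    ; exponential = λ { (a , b) (c , d) (e , f) →
        (λ { (r , s) → proj₁ (exp₂ a c e) r , proj₁ (exp₂ b d f) s }) ,
        (λ { (r , s) → proj₂ (exp₂ a c e) r , proj₂ (exp₂ b d f) s }) } } }

-- Coalesced ordinal sum, characterised up to isomorphism:
-- C is (isomorphic to) A + B iff C is covered by an order-embedded copy
-- of A below an order-embedded copy of B, with ⊤ of A glued to ⊥ of B.

record IsOrdSum {a₁ a₂ a₃ b₁ b₂ b₃ c₁ c₂ c₃ : Level}
                (A : HeytingAlgebra a₁ a₂ a₃) (B : HeytingAlgebra b₁ b₂ b₃)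
                (C : HeytingAlgebra c₁ c₂ c₃)
                : Set (a₁ ⊔ a₂ ⊔ a₃ ⊔ b₁ ⊔ b₂ ⊔ b₃ ⊔ c₁ ⊔ c₂ ⊔ c₃) where
  private
    module A = HeytingAlgebra A
    module B = HeytingAlgebra B
    module C = HeytingAlgebra C
  field
    ιA      : A.Carrier → C.Carrier
    ιB      : B.Carrier → C.Carrier
    ιA-cong : ∀ {x y} → x A.≈ y → ιA x C.≈ ιA y
    ιB-cong : ∀ {x y} → x B.≈ y → ιB x C.≈ ιB y
    ιA-mono : ∀ {x y} → x A.≤ y → ιA x C.≤ ιA y
    ιA-refl : ∀ {x y} → ιA x C.≤ ιA y → x A.≤ y
    ιB-mono : ∀ {x y} → x B.≤ y → ιB x C.≤ ιB y
    ιB-refl : ∀ {x y} → ιB x C.≤ ιB y → x B.≤ y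
    glue    : ιA A.⊤ C.≈ ιB B.⊥
    cover   : ∀ z → (∃ λ x → ιA x C.≈ z) ⊎ (∃ λ y → ιB y C.≈ z)

record IsHom {a₁ a₂ a₃ b₁ b₂ b₃ : Level}
             (A : HeytingAlgebra a₁ a₂ a₃) (B : HeytingAlgebra b₁ b₂ b₃)
             (f : HeytingAlgebra.Carrier A → HeytingAlgebra.Carrier B)
             : Set (a₁ ⊔ a₂ ⊔ b₁ ⊔ b₂) where
  private
    module A = HeytingAlgebra A
    module B = HeytingAlgebra B
  field
    cong  : ∀ {x y} → x A.≈ y → f x B.≈ f y
    hom-∧ : ∀ x y → f (x A.∧ y) B.≈ (f x B.∧ f y)
    hom-∨ : ∀ x y → f (x A.∨ y) B.≈ (f x B.∨ f y)
    hom-⇨ : ∀ x y → f (x A.⇨ y) B.≈ (f x B.⇨ f y)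
    hom-¬ : ∀ x → f (x A.⇨ A.⊥) B.≈ (f x B.⇨ B.⊥)

Surjective : {a₁ a₂ a₃ b₁ b₂ b₃ : Level}
             (A : HeytingAlgebra a₁ a₂ a₃) (B : HeytingAlgebra b₁ b₂ b₃) →
             (HeytingAlgebra.Carrier A → HeytingAlgebra.Carrier B) → Set (a₁ ⊔ b₁ ⊔ b₂)
Surjective A B h = ∀ y → ∃ λ x → HeytingAlgebra._≈_ B (h x) y

infixr 7 _∧ₜ_
infixr 6 _∨ₜ_
infixr 5 _⇒ₜ_

data Term : Set where
  var   : ℕ → Term
  _∧ₜ_  : Term → Term → Term
  _∨ₜ_  : Term → Term → Term
  _⇒ₜ_  : Term → Term → Term
  ¬ₜ_   : Term → Term

⟦_⟧ : {a₁ a₂ a₃ : Level} {A : HeytingAlgebra a₁ a₂ a₃} →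
      Term → (ℕ → HeytingAlgebra.Carrier A) → HeytingAlgebra.Carrier A
⟦_⟧ {A = A} (var n)   ρ = ρ n
⟦_⟧ {A = A} (s ∧ₜ t)  ρ = HeytingAlgebra._∧_ A (⟦_⟧ {A = A} s ρ) (⟦_⟧ {A = A} t ρ)
⟦_⟧ {A = A} (s ∨ₜ t)  ρ = HeytingAlgebra._∨_ A (⟦_⟧ {A = A} s ρ) (⟦_⟧ {A = A} t ρ)
⟦_⟧ {A = A} (s ⇒ₜ t)  ρ = HeytingAlgebra._⇨_ A (⟦_⟧ {A = A} s ρ) (⟦_⟧ {A = A} t ρ)
⟦_⟧ {A = A} (¬ₜ s)    ρ = HeytingAlgebra._⇨_ A (⟦_⟧ {A = A} s ρ) (HeytingAlgebra.⊥ A)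

-- A variety of Heyting algebras is given by a set of identities.
Variety : Set₁
Variety = Pred (Term × Term) 0ℓ

_∈V_ : {a₁ a₂ a₃ : Level} → HeytingAlgebra a₁ a₂ a₃ → Variety → Set (a₁ ⊔ a₂)
A ∈V V = ∀ s t → (s , t) ∈ V → ∀ (ρ : ℕ → HeytingAlgebra.Carrier A) →
         HeytingAlgebra._≈_ A (⟦_⟧ {A = A} s ρ) (⟦_⟧ {A = A} t ρ)

Projective : {a₁ a₂ a₃ c₁ c₂ c₃ : Level} → Variety → HeytingAlgebra c₁ c₂ c₃ →
             Set (lsuc (a₁ ⊔ a₂ ⊔ a₃) ⊔ c₁ ⊔ c₂)
Projective {a₁} {a₂} {a₃} V C =
  (A₁ A₂ : HeytingAlgebra a₁ a₂ a₃) → A₁ ∈V V → A₂ ∈V V →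
  (h : HeytingAlgebra.Carrier A₁ → HeytingAlgebra.Carrier A₂) → IsHom A₁ A₂ h → Surjective A₁ A₂ h →
  (f : HeytingAlgebra.Carrier C → HeytingAlgebra.Carrier A₂) → IsHom C A₂ f →
  ∃ λ (g : HeytingAlgebra.Carrier C → HeytingAlgebra.Carrier A₁) →
    IsHom C A₁ g × (∀ x → HeytingAlgebra._≈_ A₂ (h (g x)) (f x))

{-# OPTIONS --safe #-}
module Submission where

-- Given h : B₁ → B₂ onto and f : A + Y + Z₂ → B₂, restrict f to the subalgebra
-- A ∪ {⊤} ≅ A + Z₂ and lift it by projectivity.  What remains is to find
-- preimages of the elements of Y above the image e of the top of A.  An element
-- x ≥ e acts correctly on the image of A as soon as it does so on e, since
-- x ⇨ a ≤ e ⇨ a = a for a < e.  For Y = Z₂ the preimage b ∨ (b ⇨ e) of the top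
-- works, for any preimage b; for Y = Z₄ the atoms are lifted to b ⇨ e and
-- (b ⇨ e) ⇨ e, for any preimage b of one atom.

open import Defs
open import Level using (Level; _⊔_) renaming (suc to lsuc)
open import Data.Bool using (Bool; true; false; if_then_else_; b≤b; f≤t)
open import Data.Product using (_×_; _,_; proj₁; proj₂; ∃)
open import Data.Sum using (_⊎_; inj₁; inj₂; [_,_]′)
open import Function using (_∘_)
open import Relation.Binary.Lattice.Bundles using (HeytingAlgebra)
open import Relation.Binary.PropositionalEquality using () renaming (refl to ≡-refl)
import Relation.Binary.Lattice.Properties.HeytingAlgebra as HeytingProperties
import Relation.Binary.Lattice.Properties.MeetSemilattice as MeetProperties
import Relation.Binary.Lattice.Properties.JoinSemilattice as JoinProperties

private
  variable
    x₁ x₂ x₃ y₁ y₂ y₃ b₁ b₂ b₃ c₁ c₂ c₃ : Level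

-- Elementary laws of Heyting algebras.

module Heyting (L : HeytingAlgebra x₁ x₂ x₃) where
  open HeytingAlgebra L public
  open HeytingProperties L public
    using (⇨-eval; ⇨-unit; y≤x⇨y; ⇨-cong; ⇨-distribˡ-∨-∧; ⇨ˡ-contravariant)
  open MeetProperties meetSemilattice public
    using (∧-comm; ∧-cong; y≤x⇒x∧y≈y)
  open JoinProperties joinSemilattice public
    using (∨-comm; ∨-cong; x≤y⇒x∨y≈y)

  ≤-resp : ∀ {x x′ y y′} → x ≈ x′ → y ≈ y′ → x ≤ y → x′ ≤ y′
  ≤-resp p q r = trans (reflexive (Eq.sym p)) (trans r (reflexive q))

  x≤y⇒x∧y≈x : ∀ {x y} → x ≤ y → x ∧ y ≈ x
  x≤y⇒x∧y≈x p = Eq.trans (∧-comm _ _) (y≤x⇒x∧y≈y p)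

  y≤x⇒x∨y≈x : ∀ {x y} → y ≤ x → x ∨ y ≈ x
  y≤x⇒x∨y≈x p = Eq.trans (∨-comm _ _) (x≤y⇒x∨y≈y p)

  x≤y⇒x⇨y≈⊤ : ∀ {x y} → x ≤ y → x ⇨ y ≈ ⊤
  x≤y⇒x⇨y≈⊤ p = antisym (maximum _) (transpose-⇨ (trans (x∧y≤y _ _) p))

  ⊤⇨x≈x : ∀ x → ⊤ ⇨ x ≈ x
  ⊤⇨x≈x x = antisym (trans (∧-greatest refl (maximum _)) ⇨-eval) y≤x⇨y

-- Pre-homomorphisms and homomorphisms.

-- The maps that occur as restrictions of homomorphisms to the summands of an
-- ordinal sum: the two implications may differ on x ≤ y, where the value is the
-- top of the summand in one algebra but the top of the whole sum in the other.
record IsPreHom (X : HeytingAlgebra x₁ x₂ x₃) (B : HeytingAlgebra b₁ b₂ b₃)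
                (f : HeytingAlgebra.Carrier X → HeytingAlgebra.Carrier B)
                : Set (x₁ ⊔ x₂ ⊔ x₃ ⊔ b₁ ⊔ b₂) where
  private
    module X = HeytingAlgebra X
    module B = HeytingAlgebra B
  field
    cong  : ∀ {x y} → x X.≈ y → f x B.≈ f y
    hom-∧ : ∀ x y → f (x X.∧ y) B.≈ (f x B.∧ f y)
    hom-∨ : ∀ x y → f (x X.∨ y) B.≈ (f x B.∨ f y)
    hom-⇨ : ∀ x y → x X.≤ y ⊎ f (x X.⇨ y) B.≈ (f x B.⇨ f y)

module _ {X : HeytingAlgebra x₁ x₂ x₃} {B : HeytingAlgebra b₁ b₂ b₃}
         {f : HeytingAlgebra.Carrier X → HeytingAlgebra.Carrier B} where
  private
    module X = Heyting X
    module B = Heyting B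

  preHom-mono : IsPreHom X B f → ∀ {x y} → x X.≤ y → f x B.≤ f y
  preHom-mono F {x} {y} p = B.trans
    (B.reflexive (B.Eq.trans (F.cong (X.Eq.sym (X.x≤y⇒x∧y≈x p))) (F.hom-∧ x y)))
    (B.x∧y≤y _ _)
    where module F = IsPreHom F

  IsHom⇒IsPreHom : IsHom X B f → IsPreHom X B f
  IsHom⇒IsPreHom F = record
    { cong = F.cong ; hom-∧ = F.hom-∧ ; hom-∨ = F.hom-∨ ; hom-⇨ = λ x y → inj₂ (F.hom-⇨ x y) }
    where module F = IsHom F

  -- `IsHom` lists no constants: the top is recovered as `⊤ ⇨ ⊤` and, in `hom-⊥`, the bottom as the
  -- negation of `⊤`.
  hom-⊤ : IsHom X B f → f X.⊤ B.≈ B.⊤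
  hom-⊤ F = B.Eq.trans (F.cong (X.Eq.sym X.⇨-unit)) (B.Eq.trans (F.hom-⇨ X.⊤ X.⊤) B.⇨-unit)
    where module F = IsHom F

  hom-⊥ : IsHom X B f → f X.⊥ B.≈ B.⊥
  hom-⊥ F = B.Eq.trans (F.cong (X.Eq.sym (X.⊤⇨x≈x _)))
    (B.Eq.trans (F.hom-¬ X.⊤) (B.Eq.trans (B.⇨-cong (hom-⊤ F) B.Eq.refl) (B.⊤⇨x≈x _)))
    where module F = IsHom F

  -- The implication clause is waived only for `x ≤ y`. There `x ⇨ y` is `⊤`, and so is `f x ⇨ f y`
  -- by monotonicity, so preserving `⊤` closes the gap.
  preHom⇒hom : IsPreHom X B f → f X.⊤ B.≈ B.⊤ → f X.⊥ B.≈ B.⊥ → IsHom X B f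
  preHom⇒hom F f⊤ f⊥ = record
    { cong = F.cong ; hom-∧ = F.hom-∧ ; hom-∨ = F.hom-∨ ; hom-⇨ = hom-⇨
    ; hom-¬ = λ x → B.Eq.trans (hom-⇨ x X.⊥) (B.⇨-cong B.Eq.refl f⊥) }
    where
    module F = IsPreHom F
    hom-⇨ : ∀ x y → f (x X.⇨ y) B.≈ (f x B.⇨ f y)
    hom-⇨ x y with F.hom-⇨ x y
    ... | inj₂ q = q
    ... | inj₁ p = B.Eq.trans (F.cong (X.x≤y⇒x⇨y≈⊤ p))
                     (B.Eq.trans f⊤ (B.Eq.sym (B.x≤y⇒x⇨y≈⊤ (preHom-mono F p))))

  -- On comparable pairs monotonicity already determines meets and joins, so lattice work remains
  -- only for incomparable pairs.
  mono⇒preHom :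
    (∀ {x y} → x X.≈ y → f x B.≈ f y) →
    (∀ {x y} → x X.≤ y → f x B.≤ f y) →
    (∀ x y → x X.≤ y ⊎ y X.≤ x ⊎
      (f (x X.∧ y) B.≈ (f x B.∧ f y) × f (x X.∨ y) B.≈ (f x B.∨ f y))) →
    (∀ x y → x X.≤ y ⊎ f (x X.⇨ y) B.≈ (f x B.⇨ f y)) →
    IsPreHom X B f
  mono⇒preHom cong mono compare imp = record
    { cong = cong ; hom-∧ = hom-∧ ; hom-∨ = hom-∨ ; hom-⇨ = imp }
    where
    hom-∧ : ∀ x y → f (x X.∧ y) B.≈ (f x B.∧ f y)
    hom-∧ x y with compare x y
    ... | inj₁ p = B.Eq.trans (cong (X.x≤y⇒x∧y≈x p)) (B.Eq.sym (B.x≤y⇒x∧y≈x (mono p)))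
    ... | inj₂ (inj₁ p) = B.Eq.trans (cong (X.y≤x⇒x∧y≈y p)) (B.Eq.sym (B.y≤x⇒x∧y≈y (mono p)))
    ... | inj₂ (inj₂ (p , _)) = p

    hom-∨ : ∀ x y → f (x X.∨ y) B.≈ (f x B.∨ f y)
    hom-∨ x y with compare x y
    ... | inj₁ p = B.Eq.trans (cong (X.x≤y⇒x∨y≈y p)) (B.Eq.sym (B.x≤y⇒x∨y≈y (mono p)))
    ... | inj₂ (inj₁ p) = B.Eq.trans (cong (X.y≤x⇒x∨y≈x p)) (B.Eq.sym (B.y≤x⇒x∨y≈x (mono p)))
    ... | inj₂ (inj₂ (_ , p)) = p

-- Reflection of order is assumed because the outer map may waive its clause at `ι x ≤ ι y`, which
-- has to become a waiver at `x ≤ y`.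
preHom-∘ : {X : HeytingAlgebra x₁ x₂ x₃} {C : HeytingAlgebra c₁ c₂ c₃} {B : HeytingAlgebra b₁ b₂ b₃}
           {ι : HeytingAlgebra.Carrier X → HeytingAlgebra.Carrier C}
           {f : HeytingAlgebra.Carrier C → HeytingAlgebra.Carrier B} →
           (∀ {x y} → HeytingAlgebra._≤_ C (ι x) (ι y) → HeytingAlgebra._≤_ X x y) →
           IsPreHom X C ι → IsPreHom C B f → IsPreHom X B (f ∘ ι)
preHom-∘ {X = X} {B = B} {ι} {f} reflects I F = record
  { cong  = λ p → F.cong (I.cong p)
  ; hom-∧ = λ x y → B.Eq.trans (F.cong (I.hom-∧ x y)) (F.hom-∧ _ _)
  ; hom-∨ = λ x y → B.Eq.trans (F.cong (I.hom-∨ x y)) (F.hom-∨ _ _)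
  ; hom-⇨ = hom-⇨ }
  where
  module X = HeytingAlgebra X
  module B = HeytingAlgebra B
  module I = IsPreHom I
  module F = IsPreHom F
  hom-⇨ : ∀ x y → x X.≤ y ⊎ f (ι (x X.⇨ y)) B.≈ (f (ι x) B.⇨ f (ι y))
  hom-⇨ x y with I.hom-⇨ x y | F.hom-⇨ (ι x) (ι y)
  ... | inj₁ p | _      = inj₁ p
  ... | inj₂ _ | inj₁ p = inj₁ (reflects p)
  ... | inj₂ p | inj₂ q = inj₂ (B.Eq.trans (F.cong p) q)

-- The two summands inside an ordinal sum.

module OrdSum {X : HeytingAlgebra x₁ x₂ x₃} {Y : HeytingAlgebra y₁ y₂ y₃}
              {C : HeytingAlgebra c₁ c₂ c₃} (S : IsOrdSum X Y C) where
  private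
    module X = Heyting X
    module Y = Heyting Y
    module C = Heyting C
  open IsOrdSum S public
    renaming ( ιA to ιX; ιA-cong to ιX-cong; ιA-mono to ιX-mono; ιA-refl to ιX-refl
             ; ιB to ιY; ιB-cong to ιY-cong; ιB-mono to ιY-mono; ιB-refl to ιY-refl )

  ιX≤ιY : ∀ x y → ιX x C.≤ ιY y
  ιX≤ιY x y = C.trans (ιX-mono (X.maximum x)) (C.trans (C.reflexive glue) (ιY-mono (Y.minimum y)))

  ιY≤ιX⇒⊤≤ : ∀ {x y} → ιY y C.≤ ιX x → X.⊤ X.≤ x
  ιY≤ιX⇒⊤≤ p = ιX-refl (C.trans (ιX≤ιY _ _) p)

  ιY≤ιX⇒≤⊥ : ∀ {x y} → ιY y C.≤ ιX x → y Y.≤ Y.⊥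
  ιY≤ιX⇒≤⊥ p = ιY-refl (C.trans p (ιX≤ιY _ _))

  -- An element of the upper summand lying below the glue point must be the glue point. With
  -- `above`, this puts values of operations of `C` back into a summand, where the order embedding
  -- identifies them with the operations of that summand.
  below : ∀ {z} → z C.≤ ιX X.⊤ → ∃ λ x → ιX x C.≈ z
  below {z} p with cover z
  ... | inj₁ c = c
  ... | inj₂ (y , q) = X.⊤ , C.antisym (C.trans (ιX≤ιY _ y) (C.reflexive q)) p

  above : ∀ {z} → ιX X.⊤ C.≤ z → ∃ λ y → ιY y C.≈ z
  above {z} p with cover z
  ... | inj₂ c = c
  ... | inj₁ (x , q) = Y.⊥ ,
    C.antisym (C.trans (C.reflexive (C.Eq.sym glue)) p) (C.trans (C.reflexive (C.Eq.sym q)) (ιX≤ιY _ _))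

  ιX-isPreHom : IsPreHom X C ιX
  ιX-isPreHom = record { cong = ιX-cong ; hom-∧ = hom-∧ ; hom-∨ = hom-∨ ; hom-⇨ = hom-⇨ }
    where
    hom-∧ : ∀ x y → ιX (x X.∧ y) C.≈ (ιX x C.∧ ιX y)
    hom-∧ x y with below (C.trans (C.x∧y≤x (ιX x) (ιX y)) (ιX-mono (X.maximum x)))
    ... | w , p = C.antisym
      (C.∧-greatest (ιX-mono (X.x∧y≤x x y)) (ιX-mono (X.x∧y≤y x y)))
      (C.≤-resp p C.Eq.refl (ιX-mono (X.∧-greatest
        (ιX-refl (C.≤-resp (C.Eq.sym p) C.Eq.refl (C.x∧y≤x _ _)))
        (ιX-refl (C.≤-resp (C.Eq.sym p) C.Eq.refl (C.x∧y≤y _ _))))))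

    hom-∨ : ∀ x y → ιX (x X.∨ y) C.≈ (ιX x C.∨ ιX y)
    hom-∨ x y with below (C.∨-least (ιX-mono (X.maximum x)) (ιX-mono (X.maximum y)))
    ... | w , p = C.antisym
      (C.≤-resp C.Eq.refl p (ιX-mono (X.∨-least
        (ιX-refl (C.≤-resp C.Eq.refl (C.Eq.sym p) (C.x≤x∨y _ _)))
        (ιX-refl (C.≤-resp C.Eq.refl (C.Eq.sym p) (C.y≤x∨y _ _))))))
      (C.∨-least (ιX-mono (X.x≤x∨y x y)) (ιX-mono (X.y≤x∨y x y)))

    hom-⇨ : ∀ x y → x X.≤ y ⊎ ιX (x X.⇨ y) C.≈ (ιX x C.⇨ ιX y)
    hom-⇨ x y with cover (ιX x C.⇨ ιX y)
    ... | inj₁ (w , p) = inj₂ (C.antisym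
      (C.transpose-⇨ (C.≤-resp (hom-∧ _ _) C.Eq.refl (ιX-mono X.⇨-eval)))
      (C.≤-resp p C.Eq.refl (ιX-mono (X.transpose-⇨ (ιX-refl (C.≤-resp (C.Eq.sym (hom-∧ _ _)) C.Eq.refl
        (C.transpose-∧ (C.reflexive p))))))))
    -- An implication lying in the upper summand dominates `ιX x`, and modus ponens then gives
    -- `ιX x ≤ ιX y`.
    ... | inj₂ (w , p) = inj₁ (ιX-refl (C.trans
      (C.∧-greatest (ιX≤ιY x w) C.refl) (C.transpose-∧ (C.reflexive p))))

  ιY-isPreHom : IsPreHom Y C ιY
  ιY-isPreHom = record { cong = ιY-cong ; hom-∧ = hom-∧ ; hom-∨ = hom-∨ ; hom-⇨ = λ x y → inj₂ (hom-⇨ x y) }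
    where
    hom-∧ : ∀ x y → ιY (x Y.∧ y) C.≈ (ιY x C.∧ ιY y)
    hom-∧ x y with above (C.∧-greatest (ιX≤ιY X.⊤ x) (ιX≤ιY X.⊤ y))
    ... | w , p = C.antisym
      (C.∧-greatest (ιY-mono (Y.x∧y≤x x y)) (ιY-mono (Y.x∧y≤y x y)))
      (C.≤-resp p C.Eq.refl (ιY-mono (Y.∧-greatest
        (ιY-refl (C.≤-resp (C.Eq.sym p) C.Eq.refl (C.x∧y≤x _ _)))
        (ιY-refl (C.≤-resp (C.Eq.sym p) C.Eq.refl (C.x∧y≤y _ _))))))

    hom-∨ : ∀ x y → ιY (x Y.∨ y) C.≈ (ιY x C.∨ ιY y)
    hom-∨ x y with above (C.trans (ιX≤ιY X.⊤ x) (C.x≤x∨y (ιY x) (ιY y)))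
    ... | w , p = C.antisym
      (C.≤-resp C.Eq.refl p (ιY-mono (Y.∨-least
        (ιY-refl (C.≤-resp C.Eq.refl (C.Eq.sym p) (C.x≤x∨y _ _)))
        (ιY-refl (C.≤-resp C.Eq.refl (C.Eq.sym p) (C.y≤x∨y _ _))))))
      (C.∨-least (ιY-mono (Y.x≤x∨y x y)) (ιY-mono (Y.y≤x∨y x y)))

    hom-⇨ : ∀ x y → ιY (x Y.⇨ y) C.≈ (ιY x C.⇨ ιY y)
    hom-⇨ x y with above (C.trans (ιX≤ιY X.⊤ y) (C.y≤x⇨y {ιY x}))
    ... | w , p = C.antisym
      (C.transpose-⇨ (C.≤-resp (hom-∧ _ _) C.Eq.refl (ιY-mono Y.⇨-eval)))
      (C.≤-resp p C.Eq.refl (ιY-mono (Y.transpose-⇨ (ιY-refl (C.≤-resp (C.Eq.sym (hom-∧ _ _)) C.Eq.refl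
        (C.transpose-∧ (C.reflexive p)))))))

  -- If the implication lies in the lower summand, it is below `ιY y`, so modus ponens bounds it by
  -- `ιX x`. If it lies in the upper one, it and `ιY y` both dominate the glue point, which is
  -- therefore below `ιX x`.
  ιY⇨ιX : ∀ y x → X.⊤ X.≤ x ⊎ ιX x C.≈ (ιY y C.⇨ ιX x)
  ιY⇨ιX y x with cover (ιY y C.⇨ ιX x)
  ... | inj₁ (w , p) = inj₂ (C.antisym C.y≤x⇨y
    (C.trans (C.∧-greatest C.refl (C.trans (C.reflexive (C.Eq.sym p)) (ιX≤ιY w y))) C.⇨-eval))
  ... | inj₂ (w , p) = inj₁ (ιX-refl (C.trans
    (C.∧-greatest (ιX≤ιY X.⊤ w) (ιX≤ιY X.⊤ y)) (C.transpose-∧ (C.reflexive p))))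

  ιX-⊥ : ιX X.⊥ C.≈ C.⊥
  ιX-⊥ with below (C.minimum (ιX X.⊤))
  ... | w , p = C.antisym (C.≤-resp C.Eq.refl p (ιX-mono (X.minimum w))) (C.minimum _)

  ιY-⊤ : ιY Y.⊤ C.≈ C.⊤
  ιY-⊤ with above (C.maximum (ιX X.⊤))
  ... | w , p = C.antisym (C.maximum _) (C.≤-resp p C.Eq.refl (ιY-mono (Y.maximum w)))

-- Gluing pre-homomorphisms along an ordinal sum.

module Glue {X : HeytingAlgebra x₁ x₂ x₃} {Y : HeytingAlgebra y₁ y₂ y₃}
            {C : HeytingAlgebra c₁ c₂ c₃} {B : HeytingAlgebra b₁ b₂ b₃}
            (S : IsOrdSum X Y C)
            {g : HeytingAlgebra.Carrier X → HeytingAlgebra.Carrier B}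
            {k : HeytingAlgebra.Carrier Y → HeytingAlgebra.Carrier B}
            (G : IsPreHom X B g) (K : IsPreHom Y B k)
            (g⊤≈k⊥ : HeytingAlgebra._≈_ B (g (HeytingAlgebra.⊤ X)) (k (HeytingAlgebra.⊥ Y))) where
  private
    module X = Heyting X
    module Y = Heyting Y
    module C = Heyting C
    module B = Heyting B
    module G = IsPreHom G
    module K = IsPreHom K
  open OrdSum S
  private
    module IX = IsPreHom ιX-isPreHom
    module IY = IsPreHom ιY-isPreHom

  glued : C.Carrier → B.Carrier
  glued z = [ g ∘ proj₁ , k ∘ proj₁ ]′ (cover z)

  g≤k : ∀ x y → g x B.≤ k y
  g≤k x y = B.trans (preHom-mono G (X.maximum x))
    (B.trans (B.reflexive g⊤≈k⊥) (preHom-mono K (Y.minimum y)))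

  k≤g : ∀ {x y} → ιY y C.≤ ιX x → k y B.≤ g x
  k≤g p = B.trans (preHom-mono K (ιY≤ιX⇒≤⊥ p))
    (B.trans (B.reflexive (B.Eq.sym g⊤≈k⊥)) (preHom-mono G (ιY≤ιX⇒⊤≤ p)))

  -- The value does not depend on the preimage chosen by `cover`: the summands overlap only at the
  -- glue point, where `g` and `k` agree.
  glued-X : ∀ {x z} → ιX x C.≈ z → glued z B.≈ g x
  glued-X {x} {z} p with cover z
  ... | inj₁ (w , q) = G.cong (X.antisym (ιX-refl (C.reflexive e)) (ιX-refl (C.reflexive (C.Eq.sym e))))
    where e = C.Eq.trans q (C.Eq.sym p)
  ... | inj₂ (w , q) = B.antisym (k≤g (C.reflexive (C.Eq.trans q (C.Eq.sym p)))) (g≤k x w)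

  glued-Y : ∀ {y z} → ιY y C.≈ z → glued z B.≈ k y
  glued-Y {y} {z} p with cover z
  ... | inj₁ (w , q) = B.antisym (g≤k w y) (k≤g (C.reflexive (C.Eq.trans p (C.Eq.sym q))))
  ... | inj₂ (w , q) = K.cong (Y.antisym (ιY-refl (C.reflexive e)) (ιY-refl (C.reflexive (C.Eq.sym e))))
    where e = C.Eq.trans q (C.Eq.sym p)

  glued-cong : ∀ {z w} → z C.≈ w → glued z B.≈ glued w
  glued-cong {z} {w} p with cover z
  ... | inj₁ (x , q) = B.Eq.sym (glued-X (C.Eq.trans q p))
  ... | inj₂ (y , q) = B.Eq.sym (glued-Y (C.Eq.trans q p))

  glued-isPreHom : IsPreHom C B glued
  glued-isPreHom = mono⇒preHom glued-cong mono compare imp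
    where
    mono : ∀ {z w} → z C.≤ w → glued z B.≤ glued w
    mono {z} {w} p with cover z | cover w
    ... | inj₁ (x , q) | inj₁ (y , r) = preHom-mono G (ιX-refl (C.≤-resp (C.Eq.sym q) (C.Eq.sym r) p))
    ... | inj₁ (x , q) | inj₂ (y , r) = g≤k x y
    ... | inj₂ (x , q) | inj₁ (y , r) = k≤g (C.≤-resp (C.Eq.sym q) (C.Eq.sym r) p)
    ... | inj₂ (x , q) | inj₂ (y , r) = preHom-mono K (ιY-refl (C.≤-resp (C.Eq.sym q) (C.Eq.sym r) p))

    compare : ∀ z w → z C.≤ w ⊎ w C.≤ z ⊎
      (glued (z C.∧ w) B.≈ (glued z B.∧ glued w) × glued (z C.∨ w) B.≈ (glued z B.∨ glued w))
    compare z w with cover z | cover w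
    ... | inj₁ (x , q) | inj₁ (y , r) = inj₂ (inj₂
      ( B.Eq.trans (glued-X (C.Eq.trans (IX.hom-∧ x y) (C.∧-cong q r))) (G.hom-∧ x y)
      , B.Eq.trans (glued-X (C.Eq.trans (IX.hom-∨ x y) (C.∨-cong q r))) (G.hom-∨ x y)))
    ... | inj₁ (x , q) | inj₂ (y , r) = inj₁ (C.≤-resp q r (ιX≤ιY x y))
    ... | inj₂ (x , q) | inj₁ (y , r) = inj₂ (inj₁ (C.≤-resp r q (ιX≤ιY y x)))
    ... | inj₂ (x , q) | inj₂ (y , r) = inj₂ (inj₂
      ( B.Eq.trans (glued-Y (C.Eq.trans (IY.hom-∧ x y) (C.∧-cong q r))) (K.hom-∧ x y)
      , B.Eq.trans (glued-Y (C.Eq.trans (IY.hom-∨ x y) (C.∨-cong q r))) (K.hom-∨ x y)))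

    imp-Y : ∀ {z w} x y → ιY x C.≈ z → ιY y C.≈ w →
            z C.≤ w ⊎ glued (z C.⇨ w) B.≈ (k x B.⇨ k y)
    imp-Y x y q r with IY.hom-⇨ x y | K.hom-⇨ x y
    ... | inj₁ p | _      = inj₁ (C.≤-resp q r (ιY-mono p))
    ... | inj₂ _ | inj₁ p = inj₁ (C.≤-resp q r (ιY-mono p))
    ... | inj₂ p | inj₂ e = inj₂ (B.Eq.trans (glued-Y (C.Eq.trans p (C.⇨-cong q r))) e)

    -- Here `w` is the glue point, so it is read as the bottom of `Y` and the implication is
    -- computed there.
    imp-Y⊤ : ∀ {z w} y x → ιY y C.≈ z → ιX x C.≈ w → X.⊤ X.≤ x →
             z C.≤ w ⊎ glued (z C.⇨ w) B.≈ (k y B.⇨ g x)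
    imp-Y⊤ y x q r ⊤≤x with X.antisym ⊤≤x (X.maximum x)
    ... | ⊤≈x with imp-Y y Y.⊥ q (C.Eq.trans (C.Eq.sym glue) (C.Eq.trans (ιX-cong ⊤≈x) r))
    ...   | inj₁ s = inj₁ s
    ...   | inj₂ s = inj₂ (B.Eq.trans s (B.⇨-cong B.Eq.refl
                       (B.Eq.trans (B.Eq.sym g⊤≈k⊥) (G.cong ⊤≈x))))

    -- The only real interaction of the summands. For `x` other than the top, the clause of `g` at
    -- `⊤ ⇨ x` gives `g ⊤ ⇨ g x ≈ g x`. As `g ⊤ ≤ k y`, antitonicity bounds `k y ⇨ g x` by `g x`.
    imp-YX : ∀ {z w} y x → ιY y C.≈ z → ιX x C.≈ w →
             z C.≤ w ⊎ glued (z C.⇨ w) B.≈ (k y B.⇨ g x)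
    imp-YX y x q r with ιY⇨ιX y x | G.hom-⇨ X.⊤ x
    ... | inj₁ p | _      = imp-Y⊤ y x q r p
    ... | inj₂ _ | inj₁ p = imp-Y⊤ y x q r p
    ... | inj₂ p | inj₂ e = inj₂ (B.Eq.trans (glued-X (C.Eq.trans p (C.⇨-cong q r)))
      (B.antisym B.y≤x⇨y (B.trans (B.⇨ˡ-contravariant (g≤k X.⊤ y))
        (B.reflexive (B.Eq.sym (B.Eq.trans (G.cong (X.Eq.sym (X.⊤⇨x≈x x))) e))))))

    imp : ∀ z w → z C.≤ w ⊎ glued (z C.⇨ w) B.≈ (glued z B.⇨ glued w)
    imp z w with cover z | cover w
    ... | inj₁ (x , q) | inj₂ (y , r) = inj₁ (C.≤-resp q r (ιX≤ιY x y))
    ... | inj₂ (x , q) | inj₂ (y , r) = imp-Y x y q r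
    ... | inj₂ (y , q) | inj₁ (x , r) = imp-YX y x q r
    ... | inj₁ (x , q) | inj₁ (y , r) with IX.hom-⇨ x y | G.hom-⇨ x y
    ...   | inj₁ p | _      = inj₁ (C.≤-resp q r (ιX-mono p))
    ...   | inj₂ _ | inj₁ p = inj₁ (C.≤-resp q r (ιX-mono p))
    ...   | inj₂ p | inj₂ e = inj₂ (B.Eq.trans (glued-X (C.Eq.trans p (C.⇨-cong q r))) e)

-- The two-element summand and adjoining a top.

-- The second inequality says that `d` is dense in the interval from `c` to `⊤`; it is what the sole
-- implication outside the order, `true ⇨ false`, requires.
Z₂-isPreHom : (B : HeytingAlgebra b₁ b₂ b₃) {c d : HeytingAlgebra.Carrier B} →
              HeytingAlgebra._≤_ B c d →
              HeytingAlgebra._≤_ B (HeytingAlgebra._⇨_ B d c) c →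
              IsPreHom Z₂ B (λ b → if b then d else c)
Z₂-isPreHom B {c} {d} c≤d d⇨c≤c = mono⇒preHom
  (λ { ≡-refl → B.Eq.refl })
  (λ { b≤b → B.refl ; f≤t → c≤d })
  (λ { false false → inj₁ b≤b ; false true → inj₁ f≤t ; true false → inj₂ (inj₁ f≤t) ; true true → inj₁ b≤b })
  (λ { false false → inj₁ b≤b ; false true → inj₁ f≤t ; true true → inj₁ b≤b
     ; true false → inj₂ (B.antisym B.y≤x⇨y d⇨c≤c) })
  where module B = Heyting B

module AdjoinTop {X : HeytingAlgebra x₁ x₂ x₃} {C : HeytingAlgebra c₁ c₂ c₃} {B : HeytingAlgebra b₁ b₂ b₃}
                 (S : IsOrdSum X Z₂ C)
                 {g : HeytingAlgebra.Carrier X → HeytingAlgebra.Carrier B} (G : IsPreHom X B g) where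
  private
    module X = Heyting X
    module B = Heyting B
  open Glue S G (Z₂-isPreHom B (B.maximum (g X.⊤)) (B.reflexive (B.⊤⇨x≈x _))) B.Eq.refl public

  -- The new top goes to `⊤`, which is dense over every element, so any pre-homomorphism extends to
  -- the sum and only the bottom is left to check.
  glued-isHom : g X.⊥ B.≈ B.⊥ → IsHom C B glued
  glued-isHom g⊥≈⊥ = preHom⇒hom glued-isPreHom
    (glued-Y (OrdSum.ιY-⊤ S)) (B.Eq.trans (glued-X (OrdSum.ιX-⊥ S)) g⊥≈⊥)

-- Lifting the middle summand along a surjection.

-- The value `e` at the bottom is prescribed because the lift on `A` has already fixed the image of
-- the glue point.
LiftsPreHoms : (a₁ a₂ a₃ : Level) → HeytingAlgebra y₁ y₂ y₃ → Set (lsuc (a₁ ⊔ a₂ ⊔ a₃) ⊔ y₁ ⊔ y₂ ⊔ y₃)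
LiftsPreHoms a₁ a₂ a₃ Y =
  (B₁ B₂ : HeytingAlgebra a₁ a₂ a₃)
  (h : Carrier B₁ → Carrier B₂) → IsHom B₁ B₂ h → Surjective B₁ B₂ h →
  (k : Carrier Y → Carrier B₂) → IsPreHom Y B₂ k →
  (e : Carrier B₁) → _≈_ B₂ (h e) (k (⊥ Y)) →
  ∃ λ (l : Carrier Y → Carrier B₁) →
    IsPreHom Y B₁ l × _≈_ B₁ (l (⊥ Y)) e × (∀ y → _≈_ B₂ (h (l y)) (k y))
  where open HeytingAlgebra using (Carrier; _≈_; ⊥)

Z₂-lifts : (a₁ a₂ a₃ : Level) → LiftsPreHoms a₁ a₂ a₃ Z₂
Z₂-lifts _ _ _ B₁ B₂ h H onto k K e he with onto (k true)
... | b , hb = (λ x → if x then d else e) , Z₂-isPreHom B₁ e≤d d⇨e≤e , B₁.Eq.refl , λ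
    { false → he
    ; true → B₂.Eq.trans (H.hom-∨ b (b B₁.⇨ e)) (B₂.Eq.trans
        (B₂.∨-cong hb (B₂.Eq.trans (H.hom-⇨ b e) (B₂.Eq.trans (B₂.⇨-cong hb he) k-⇨)))
        (B₂.y≤x⇒x∨y≈x (preHom-mono K f≤t))) }
  where
  module B₁ = Heyting B₁
  module B₂ = Heyting B₂
  module H = IsHom H
  -- A preimage `b` need be neither above `e` nor dense over it. Joining `b ⇨ e` repairs both:
  -- `d ⇨ e` is the meet of `b ⇨ e` and `(b ⇨ e) ⇨ e`. The image stays right, since
  -- `k true ⇨ k false` is `k false`, which lies below `k true`.
  d : B₁.Carrier
  d = b B₁.∨ (b B₁.⇨ e)
  e≤d : e B₁.≤ d
  e≤d = B₁.trans B₁.y≤x⇨y (B₁.y≤x∨y _ _)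
  d⇨e≤e : (d B₁.⇨ e) B₁.≤ e
  d⇨e≤e = B₁.trans (B₁.reflexive (B₁.Eq.trans (B₁.⇨-distribˡ-∨-∧ _ _ _) (B₁.∧-comm _ _))) B₁.⇨-eval
  k-⇨ : (k true B₂.⇨ k false) B₂.≈ k false
  k-⇨ with IsPreHom.hom-⇨ K true false
  ... | inj₂ p = B₂.Eq.sym p

-- The four-element summand.

-- The hypotheses make `p` and `q` pseudocomplements of each other relative to `e`, as the atoms of
-- `Z₄` are over the bottom. They yield that `p` and `q` meet in `e` and that their join is dense
-- over `e`.
module Diamond (B : HeytingAlgebra b₁ b₂ b₃) {e p q : HeytingAlgebra.Carrier B}
               (p⇨e≈q : HeytingAlgebra._≈_ B (HeytingAlgebra._⇨_ B p e) q)
               (q⇨e≈p : HeytingAlgebra._≈_ B (HeytingAlgebra._⇨_ B q e) p) where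
  private
    module B = Heyting B

    e≤p : e B.≤ p
    e≤p = B.trans B.y≤x⇨y (B.reflexive q⇨e≈p)
    e≤q : e B.≤ q
    e≤q = B.trans B.y≤x⇨y (B.reflexive p⇨e≈q)
    q∧p≤e : (q B.∧ p) B.≤ e
    q∧p≤e = B.transpose-∧ (B.reflexive (B.Eq.sym p⇨e≈q))
    p∧q≤e : (p B.∧ q) B.≤ e
    p∧q≤e = B.transpose-∧ (B.reflexive (B.Eq.sym q⇨e≈p))
    -- Meeting `p ⇨ q` with `p` lands in `q ∧ p`, hence below `e`; so `p ⇨ q` is below `p ⇨ e`,
    -- which is `q`.
    p⇨q≤q : (p B.⇨ q) B.≤ q
    p⇨q≤q = B.trans (B.transpose-⇨ (B.trans (B.∧-greatest B.⇨-eval (B.x∧y≤y _ _)) q∧p≤e)) (B.reflexive p⇨e≈q)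
    q⇨p≤p : (q B.⇨ p) B.≤ p
    q⇨p≤p = B.trans (B.transpose-⇨ (B.trans (B.∧-greatest B.⇨-eval (B.x∧y≤y _ _)) p∧q≤e)) (B.reflexive q⇨e≈p)
    p∨q⇨e≤e : ((p B.∨ q) B.⇨ e) B.≤ e
    p∨q⇨e≤e = B.trans (B.reflexive (B.Eq.trans (B.⇨-distribˡ-∨-∧ p q e) (B.∧-cong p⇨e≈q q⇨e≈p))) q∧p≤e

  diamond : Bool × Bool → B.Carrier
  diamond (false , false) = e
  diamond (true  , false) = p
  diamond (false , true)  = q
  -- This join may be strictly below `⊤`, so in general only a pre-homomorphism results.
  diamond (true  , true)  = p B.∨ q

  private
    open HeytingAlgebra Z₄ using () renaming (_≤_ to _≤₄_; _∧_ to _∧₄_; _∨_ to _∨₄_; _⇨_ to _⇨₄_)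

    mono : ∀ {x y} → x ≤₄ y → diamond x B.≤ diamond y
    mono (b≤b , b≤b) = B.refl
    mono {false , false} (f≤t , b≤b) = e≤p
    mono {false , true}  (f≤t , b≤b) = B.y≤x∨y _ _
    mono {false , false} (b≤b , f≤t) = e≤q
    mono {true , false}  (b≤b , f≤t) = B.x≤x∨y _ _
    mono (f≤t , f≤t) = B.trans e≤p (B.x≤x∨y _ _)

    compare : ∀ x y → x ≤₄ y ⊎ y ≤₄ x ⊎
      (diamond (x ∧₄ y) B.≈ (diamond x B.∧ diamond y) × diamond (x ∨₄ y) B.≈ (diamond x B.∨ diamond y))
    compare (false , false) y = inj₁ (HeytingAlgebra.minimum Z₄ y)
    compare (true , true) y = inj₂ (inj₁ (HeytingAlgebra.maximum Z₄ y))
    compare x (false , false) = inj₂ (inj₁ (HeytingAlgebra.minimum Z₄ x))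
    compare x (true , true) = inj₁ (HeytingAlgebra.maximum Z₄ x)
    compare (true , false) (true , false) = inj₁ (b≤b , b≤b)
    compare (false , true) (false , true) = inj₁ (b≤b , b≤b)
    compare (true , false) (false , true) =
      inj₂ (inj₂ (B.antisym (B.∧-greatest e≤p e≤q) p∧q≤e , B.Eq.refl))
    compare (false , true) (true , false) =
      inj₂ (inj₂ (B.antisym (B.∧-greatest e≤q e≤p) q∧p≤e , B.∨-comm p q))

    imp : ∀ x y → x ≤₄ y ⊎ diamond (x ⇨₄ y) B.≈ (diamond x B.⇨ diamond y)
    imp (false , false) y = inj₁ (HeytingAlgebra.minimum Z₄ y)
    imp x (true , true) = inj₁ (HeytingAlgebra.maximum Z₄ x)
    imp (true , false) (true , false) = inj₁ (b≤b , b≤b)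
    imp (false , true) (false , true) = inj₁ (b≤b , b≤b)
    imp (true , false) (false , false) = inj₂ (B.Eq.sym p⇨e≈q)
    imp (false , true) (false , false) = inj₂ (B.Eq.sym q⇨e≈p)
    imp (true , false) (false , true) = inj₂ (B.antisym B.y≤x⇨y p⇨q≤q)
    imp (false , true) (true , false) = inj₂ (B.antisym B.y≤x⇨y q⇨p≤p)
    imp (true , true) (false , false) = inj₂ (B.antisym B.y≤x⇨y p∨q⇨e≤e)
    imp (true , true) (true , false) =
      inj₂ (B.antisym B.y≤x⇨y (B.trans (B.⇨ˡ-contravariant (B.y≤x∨y p q)) q⇨p≤p))
    imp (true , true) (false , true) =
      inj₂ (B.antisym B.y≤x⇨y (B.trans (B.⇨ˡ-contravariant (B.x≤x∨y p q)) p⇨q≤q))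

  diamond-isPreHom : IsPreHom Z₄ B diamond
  diamond-isPreHom = mono⇒preHom (λ { ≡-refl → B.Eq.refl }) mono compare imp

Z₄-lifts : (a₁ a₂ a₃ : Level) → LiftsPreHoms a₁ a₂ a₃ Z₄
Z₄-lifts _ _ _ B₁ B₂ h H onto k K e he with onto (k (false , true))
... | b , hb = diamond , diamond-isPreHom , B₁.Eq.refl , λ
    { (false , false) → he
    ; (true  , false) → hp
    ; (false , true)  → hq
    ; (true  , true)  → B₂.Eq.trans (H.hom-∨ p q) (B₂.Eq.trans (B₂.∨-cong hp hq)
        (B₂.Eq.sym (IsPreHom.hom-∨ K (true , false) (false , true)))) }
  where
  module B₁ = Heyting B₁
  module B₂ = Heyting B₂
  module H = IsHom H
  p q : B₁.Carrier
  p = b B₁.⇨ e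
  q = p B₁.⇨ e
  x≤[x⇨e]⇨e : ∀ x → x B₁.≤ ((x B₁.⇨ e) B₁.⇨ e)
  x≤[x⇨e]⇨e x = B₁.transpose-⇨ (B₁.trans (B₁.reflexive (B₁.∧-comm _ _)) B₁.⇨-eval)
  -- Triple negation relative to `e` reduces to single negation.
  q⇨e≈p : (q B₁.⇨ e) B₁.≈ p
  q⇨e≈p = B₁.antisym (B₁.⇨ˡ-contravariant (x≤[x⇨e]⇨e b)) (x≤[x⇨e]⇨e p)
  open Diamond B₁ {e} {p} {q} B₁.Eq.refl q⇨e≈p
  k-⇨ʳ : (k (false , true) B₂.⇨ k (false , false)) B₂.≈ k (true , false)
  k-⇨ʳ with IsPreHom.hom-⇨ K (false , true) (false , false)
  ... | inj₂ r = B₂.Eq.sym r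
  k-⇨ˡ : (k (true , false) B₂.⇨ k (false , false)) B₂.≈ k (false , true)
  k-⇨ˡ with IsPreHom.hom-⇨ K (true , false) (false , false)
  ... | inj₂ r = B₂.Eq.sym r
  hp : h p B₂.≈ k (true , false)
  hp = B₂.Eq.trans (H.hom-⇨ b e) (B₂.Eq.trans (B₂.⇨-cong hb he) k-⇨ʳ)
  hq : h q B₂.≈ k (false , true)
  hq = B₂.Eq.trans (H.hom-⇨ p e) (B₂.Eq.trans (B₂.⇨-cong hp he) k-⇨ˡ)

-- Projectivity of the sum.

-- The lift is assembled in three layers: on `A` from the projectivity of `A₁`, on `Y` from `liftY`,
-- and the final top sent to `⊤`, which turns the glued pre-homomorphism into a homomorphism.
lifts⇒projective : {a₁ a₂ a₃ : Level} (V : Variety) {A A₁ : HeytingAlgebra a₁ a₂ a₃}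
  {Y : HeytingAlgebra y₁ y₂ y₃} {D : HeytingAlgebra x₁ x₂ x₃} {E : HeytingAlgebra c₁ c₂ c₃} →
  LiftsPreHoms a₁ a₂ a₃ Y → IsOrdSum A Z₂ A₁ → IsOrdSum A Y D → IsOrdSum D Z₂ E →
  Projective {a₁} {a₂} {a₃} V A₁ → Projective {a₁} {a₂} {a₃} V E
lifts⇒projective V {A} {A₁} {Y} {D} {E} liftY S₁ SD SE proj B₁ B₂ B₁∈V B₂∈V h H onto f F =
  GE.glued , GE.glued-isHom gD⊥ , hGE
  where
  module A = HeytingAlgebra A
  module E = HeytingAlgebra E
  module B₁ = HeytingAlgebra B₁
  module B₂ = HeytingAlgebra B₂
  module S₁ = OrdSum S₁
  module SD = OrdSum SD
  module SE = OrdSum SE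
  module H = IsHom H
  module F = IsHom F

  fD-isPreHom = preHom-∘ SE.ιX-refl SE.ιX-isPreHom (IsHom⇒IsPreHom F)
  fA-isPreHom = preHom-∘ SD.ιX-refl SD.ιX-isPreHom fD-isPreHom
  fY-isPreHom = preHom-∘ SD.ιY-refl SD.ιY-isPreHom fD-isPreHom
  -- This is `f` on the image of `A` together with the top, presented as a map from `A₁`.
  module F₁ = AdjoinTop S₁ fA-isPreHom

  fA⊥ : f (SE.ιX (SD.ιX A.⊥)) B₂.≈ B₂.⊥
  fA⊥ = B₂.Eq.trans (F.cong (E.Eq.trans (SE.ιX-cong SD.ιX-⊥) SE.ιX-⊥)) (hom-⊥ F)

  lift₁ = proj B₁ B₂ B₁∈V B₂∈V h H onto F₁.glued (F₁.glued-isHom fA⊥)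
  g₁ = proj₁ lift₁
  G₁ = proj₁ (proj₂ lift₁)
  gA = g₁ ∘ S₁.ιX
  gA-isPreHom = preHom-∘ S₁.ιX-refl S₁.ιX-isPreHom (IsHom⇒IsPreHom G₁)

  hgA : ∀ a → h (gA a) B₂.≈ f (SE.ιX (SD.ιX a))
  hgA a = B₂.Eq.trans (proj₂ (proj₂ lift₁) (S₁.ιX a)) (F₁.glued-X (HeytingAlgebra.Eq.refl A₁))

  -- The bottom of `Y` must go where the lift on `A` sends its top, so that the two pieces can be
  -- glued.
  liftedY = liftY B₁ B₂ h H onto (f ∘ SE.ιX ∘ SD.ιY) fY-isPreHom (gA A.⊤)
    (B₂.Eq.trans (hgA A.⊤) (F.cong (SE.ιX-cong SD.glue)))
  k = proj₁ liftedY

  module GD = Glue SD gA-isPreHom (proj₁ (proj₂ liftedY)) (B₁.Eq.sym (proj₁ (proj₂ (proj₂ liftedY))))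
  module GE = AdjoinTop SE GD.glued-isPreHom

  gD⊥ : GD.glued (HeytingAlgebra.⊥ D) B₁.≈ B₁.⊥
  gD⊥ = B₁.Eq.trans (GD.glued-X SD.ιX-⊥) (B₁.Eq.trans (IsHom.cong G₁ S₁.ιX-⊥) (hom-⊥ G₁))

  hGD : ∀ d → h (GD.glued d) B₂.≈ f (SE.ιX d)
  hGD d with SD.cover d
  ... | inj₁ (a , p) = B₂.Eq.trans (hgA a) (F.cong (SE.ιX-cong p))
  ... | inj₂ (y , p) = B₂.Eq.trans (proj₂ (proj₂ (proj₂ liftedY)) y) (F.cong (SE.ιX-cong p))

  hGE : ∀ z → h (GE.glued z) B₂.≈ f z
  hGE z with SE.cover z
  ... | inj₁ (d , p)     = B₂.Eq.trans (hGD d) (F.cong p)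
  -- The bottom of the last `Z₂` is the top of `D`, already covered by `hGD`.
  ... | inj₂ (false , p) = B₂.Eq.trans (hGD _) (F.cong (E.Eq.trans SE.glue p))
  ... | inj₂ (true , p)  = B₂.Eq.trans (hom-⊤ H) (B₂.Eq.sym
    (B₂.Eq.trans (F.cong (E.Eq.trans (E.Eq.sym p) SE.ιY-⊤)) (hom-⊤ F)))

theorem10 : {a₁ a₂ a₃ : Level} (V : Variety) (A A₁ : HeytingAlgebra a₁ a₂ a₃) →
    IsOrdSum A Z₂ A₁ → A₁ ∈V V → Projective {a₁} {a₂} {a₃} V A₁ →
    ((C : HeytingAlgebra a₁ a₂ a₃) → IsOrdSum A₁ Z₂ C → C ∈V V →
    Projective {a₁} {a₂} {a₃} V C)
    × ((D E : HeytingAlgebra a₁ a₂ a₃) → IsOrdSum A Z₄ D → IsOrdSum D Z₂ E → E ∈V V →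
    Projective {a₁} {a₂} {a₃} V E)
theorem10 {a₁} {a₂} {a₃} V A A₁ S₁ _ proj =
  -- For (a) the middle summand is `Z₂`, so `A₁` serves both as the known projective algebra and as
  -- the sum `D`; hence `S₁` appears twice.
  (λ C SC _ → lifts⇒projective V (Z₂-lifts a₁ a₂ a₃) S₁ S₁ SC proj) ,
  (λ D E SD SE _ → lifts⇒projective V (Z₄-lifts a₁ a₂ a₃) S₁ SD SE proj)
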